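{- For every real $c>1$, every randomized algorithm for $c$-DEC has cost at least $n^{ -O(1)}\cdot\left(2-\frac1c\right)^n$.
   Context: Let $\mathbb N=\{0,1,2,\dots\}$. Let $U$ be a finite set and $\mathcal F\subseteq 2^U$ a family of subsets (not necessarily monotone). For $\ell\in\mathbb N$, $S\subseteq U$ is an $\ell$-extension of $X\subseteq U$ if $X\cup S\in\mathcal F$ and $|S|\le\ell$. An exact extension oracle for $\mathcal F$ takes as input $X\subseteq U$ and $\ell\in\mathbb N$ and returns yes or no: if $X$ has an $\ell$-extension it returns yes with probability at least $\frac12$; if $X$ has no $\ell$-extension it returns no. (An oracle that answers exactly and deterministically is a special case.) A query $(X,\ell)$ costs $c^\ell$. In the $c$-decision problem ($c$-DEC) the input is a finite universe $U$ together with an exact extension oracle for a set family $\mathcal F$ of $U$ (the family is accessible only via the oracle); the objective is to decide whether $\mathcal F\ne\emptyset$. A randomized algorithm for $c$-DEC must, for every such input, return yes with probability at least $\frac12$ if $\mathcal F\neq\emptyset$, and always return no if $\mathcal F=\emptyset$. The cost of an execution is the sum of the costs of all oracle queries plus the number of computational operations; $\mathrm{cost}_{\mathcal A}(n)$ is the maximum cost of an execution of $\mathcal A$ on inputs with $|U|\le n$. "Has cost at least $h(n)$" means $\mathrm{cost}_{\mathcal A}(n)\ge h(n)$; $n^{ -O(1)}$ stands for the reciprocal of some polynomial in $n$ (which may depend on $c$). -}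

module Defs where

open import Data.Bool.Base using (Bool; true; false; T; if_then_else_)
import Data.Bool.Properties as Bool
open import Data.Fin.Base using (Fin)
open import Data.Fin.Subset using (Subset; _∪_; ∣_∣)
import Data.Integer.Base as ℤ
open import Data.List.Base using (List; foldr)
open import Data.Nat.Base as ℕ using (ℕ; zero; suc)
import Data.Nat.Properties as ℕ
open import Data.Product.Base using (∃; _×_; _,_; proj₁; proj₂)
open import Data.Rational.Base as ℚ using (ℚ; 0ℚ; 1ℚ; ½)
import Data.Rational.Properties as ℚ
open import Data.Rational.Solver using (module +-*-Solver)
import Data.Vec.Functional as Vector
open import Relation.Binary.PropositionalEquality using (_≡_; _≢_; refl; sym; trans; cong; cong₂; subst)
open import Relation.Nullary.Decidable.Core using (does)
open import Relation.Nullary.Negation.Core using (¬_)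

open +-*-Solver using (solve; _:+_; _:*_; _:-_; :-_; _:=_; con)

infix  4 _≤_ _<_ _≈_
infixl 6 _+_ _-_
infixl 7 _*_
infix  8 -_
infixr 8 _^_

-- Real numbers, as Cauchy sequences of rationals with a modulus of
-- convergence; equality of reals is the setoid equality _≈_.

IsCauchy : (ℕ → ℚ) → Set
IsCauchy a = ∀ ε → 0ℚ ℚ.< ε → ∃ λ N → ∀ m n → N ℕ.≤ m → N ℕ.≤ n →
             ℚ.∣ a m ℚ.- a n ∣ ℚ.≤ ε

record ℝ : Set where
  constructor mkℝ
  field
    seq    : ℕ → ℚ
    cauchy : IsCauchy seq

open ℝ public

record _≤_ (x y : ℝ) : Set where
  constructor *≤*
  field
    close : ∀ ε → 0ℚ ℚ.< ε → ∃ λ N → ∀ n → N ℕ.≤ n → seq x n ℚ.≤ seq y n ℚ.+ ε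

record _<_ (x y : ℝ) : Set where
  constructor *<*
  field
    apart : ∃ λ ε → 0ℚ ℚ.< ε × ∃ λ N → ∀ n → N ℕ.≤ n → seq x n ℚ.+ ε ℚ.≤ seq y n

_≈_ : ℝ → ℝ → Set
x ≈ y = x ≤ y × y ≤ x

private
  EventuallyBoundedBy : (ℕ → ℚ) → ℚ → Set
  EventuallyBoundedBy a B = ∃ λ N → ∀ n → N ℕ.≤ n → ℚ.∣ a n ∣ ℚ.≤ B

  inverse : (p : ℚ) → 0ℚ ℚ.< p → ℚ
  inverse p 0<p = (ℚ.1/ p) {{ℚ.>-nonZero 0<p}}

  abstract
    halve : ∀ {ε} → 0ℚ ℚ.< ε → 0ℚ ℚ.< ½ ℚ.* ε
    halve 0<ε = ℚ.*-monoʳ-<-pos ½ 0<ε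

    halves : ∀ ε → ½ ℚ.* ε ℚ.+ ½ ℚ.* ε ≡ ε
    halves ε = solve 1 (λ e → con ½ :* e :+ con ½ :* e := e) refl ε

    +-cauchy : ∀ {a b} → IsCauchy a → IsCauchy b → IsCauchy (λ n → a n ℚ.+ b n)
    +-cauchy {a} {b} ca cb ε 0<ε with ca (½ ℚ.* ε) (halve 0<ε) | cb (½ ℚ.* ε) (halve 0<ε)
    ... | N , p | M , q = N ℕ.⊔ M , λ m n N≤m N≤n → begin
      ℚ.∣ (a m ℚ.+ b m) ℚ.- (a n ℚ.+ b n) ∣           ≡⟨ cong ℚ.∣_∣ (regroup (a m) (b m) (a n) (b n)) ⟩
      ℚ.∣ (a m ℚ.- a n) ℚ.+ (b m ℚ.- b n) ∣           ≤⟨ ℚ.∣p+q∣≤∣p∣+∣q∣ (a m ℚ.- a n) (b m ℚ.- b n) ⟩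
      ℚ.∣ a m ℚ.- a n ∣ ℚ.+ ℚ.∣ b m ℚ.- b n ∣         ≤⟨ ℚ.+-mono-≤
                                                            (p m n (ℕ.m⊔n≤o⇒m≤o N M N≤m) (ℕ.m⊔n≤o⇒m≤o N M N≤n))
                                                            (q m n (ℕ.m⊔n≤o⇒n≤o N M N≤m) (ℕ.m⊔n≤o⇒n≤o N M N≤n)) ⟩
      ½ ℚ.* ε ℚ.+ ½ ℚ.* ε                             ≡⟨ halves ε ⟩
      ε                                               ∎
      where
      open ℚ.≤-Reasoning
      regroup : ∀ x y x′ y′ → (x ℚ.+ y) ℚ.- (x′ ℚ.+ y′) ≡ (x ℚ.- x′) ℚ.+ (y ℚ.- y′)
      regroup = solve 4 (λ x y x′ y′ → (x :+ y) :- (x′ :+ y′) := (x :- x′) :+ (y :- y′)) refl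

    neg-cauchy : ∀ {a} → IsCauchy a → IsCauchy (λ n → ℚ.- a n)
    neg-cauchy {a} ca ε 0<ε with ca ε 0<ε
    ... | N , p = N , λ m n N≤m N≤n →
      subst (ℚ._≤ ε) (trans (sym (ℚ.∣-p∣≡∣p∣ (a m ℚ.- a n))) (cong ℚ.∣_∣ (regroup (a m) (a n)))) (p m n N≤m N≤n)
      where
      regroup : ∀ x y → ℚ.- (x ℚ.- y) ≡ (ℚ.- x) ℚ.- (ℚ.- y)
      regroup = solve 2 (λ x y → :- (x :- y) := (:- x) :- (:- y)) refl

    0<1 : 0ℚ ℚ.< 1ℚ
    0<1 = ℚ.positive⁻¹ 1ℚ

    bounded : ∀ {a} → IsCauchy a → ∃ λ B → 0ℚ ℚ.< B × EventuallyBoundedBy a B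
    bounded {a} ca with ca 1ℚ 0<1
    ... | N , p = 1ℚ ℚ.+ ℚ.∣ a N ∣
                , ℚ.+-mono-<-≤ 0<1 (ℚ.0≤∣p∣ (a N))
                , N , λ n N≤n → begin
      ℚ.∣ a n ∣                                 ≡⟨ cong ℚ.∣_∣ (regroup (a n) (a N)) ⟩
      ℚ.∣ (a n ℚ.- a N) ℚ.+ a N ∣               ≤⟨ ℚ.∣p+q∣≤∣p∣+∣q∣ (a n ℚ.- a N) (a N) ⟩
      ℚ.∣ a n ℚ.- a N ∣ ℚ.+ ℚ.∣ a N ∣           ≤⟨ ℚ.+-monoˡ-≤ ℚ.∣ a N ∣ (p n N N≤n ℕ.≤-refl) ⟩
      1ℚ ℚ.+ ℚ.∣ a N ∣                          ∎
      where
      open ℚ.≤-Reasoning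
      regroup : ∀ x y → x ≡ (x ℚ.- y) ℚ.+ y
      regroup = solve 2 (λ x y → x := (x :- y) :+ y) refl

    *-mono-≤ : ∀ {p q r s} → 0ℚ ℚ.≤ r → 0ℚ ℚ.≤ q → p ℚ.≤ q → r ℚ.≤ s → p ℚ.* r ℚ.≤ q ℚ.* s
    *-mono-≤ {p} {q} {r} {s} 0≤r 0≤q p≤q r≤s = ℚ.≤-trans
      (ℚ.*-monoʳ-≤-nonNeg r {{ℚ.nonNegative 0≤r}} p≤q)
      (ℚ.*-monoˡ-≤-nonNeg q {{ℚ.nonNegative 0≤q}} r≤s)

    +-pos : ∀ {p q} → 0ℚ ℚ.< p → 0ℚ ℚ.< q → 0ℚ ℚ.< p ℚ.+ q
    +-pos {p} {q} 0<p 0<q =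
      ℚ.positive⁻¹ (p ℚ.+ q) {{ℚ.pos+pos⇒pos p {{ℚ.positive 0<p}} q {{ℚ.positive 0<q}}}}

    *-pos : ∀ {p q} → 0ℚ ℚ.< p → 0ℚ ℚ.< q → 0ℚ ℚ.< p ℚ.* q
    *-pos {p} {q} 0<p 0<q =
      ℚ.positive⁻¹ (p ℚ.* q) {{ℚ.pos*pos⇒pos p {{ℚ.positive 0<p}} q {{ℚ.positive 0<q}}}}

    inverse-* : ∀ p (0<p : 0ℚ ℚ.< p) → inverse p 0<p ℚ.* p ≡ 1ℚ
    inverse-* p 0<p = ℚ.*-inverseˡ p {{ℚ.>-nonZero 0<p}}

    inverse-pos : ∀ p (0<p : 0ℚ ℚ.< p) → 0ℚ ℚ.< inverse p 0<p
    inverse-pos p 0<p = ℚ.positive⁻¹ _ {{ℚ.1/pos⇒pos p {{ℚ.positive 0<p}}}}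

    *-cauchy′ : ∀ {a b A B} → 0ℚ ℚ.< A → EventuallyBoundedBy a A → 0ℚ ℚ.< B → EventuallyBoundedBy b B →
                IsCauchy a → IsCauchy b → IsCauchy (λ n → a n ℚ.* b n)
    *-cauchy′ {a} {b} {A} {B} 0<A (K , |a|≤A) 0<B (L , |b|≤B) ca cb ε 0<ε = N , close
      where
      open ℚ.≤-Reasoning
      0<A+B : 0ℚ ℚ.< A ℚ.+ B
      0<A+B = +-pos 0<A 0<B
      i δ : ℚ
      i = inverse (A ℚ.+ B) 0<A+B
      δ = i ℚ.* ε
      0<δ : 0ℚ ℚ.< δ
      0<δ = *-pos (inverse-pos (A ℚ.+ B) 0<A+B) 0<ε
      Na Nb N : ℕ
      Na = proj₁ (ca δ 0<δ)
      Nb = proj₁ (cb δ 0<δ)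
      N  = (K ℕ.⊔ L) ℕ.⊔ (Na ℕ.⊔ Nb)
      regroup : ∀ x y x′ y′ → x ℚ.* y ℚ.- x′ ℚ.* y′ ≡ x ℚ.* (y ℚ.- y′) ℚ.+ y′ ℚ.* (x ℚ.- x′)
      regroup = solve 4 (λ x y x′ y′ → x :* y :- x′ :* y′ := x :* (y :- y′) :+ y′ :* (x :- x′)) refl
      factor : ∀ x y z w → x ℚ.* (z ℚ.* w) ℚ.+ y ℚ.* (z ℚ.* w) ≡ (z ℚ.* (x ℚ.+ y)) ℚ.* w
      factor = solve 4 (λ x y z w → x :* (z :* w) :+ y :* (z :* w) := (z :* (x :+ y)) :* w) refl
      collect : A ℚ.* δ ℚ.+ B ℚ.* δ ≡ ε
      collect = trans (factor A B i ε) (trans (cong (ℚ._* ε) (inverse-* (A ℚ.+ B) 0<A+B)) (ℚ.*-identityˡ ε))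
      close : ∀ m n → N ℕ.≤ m → N ℕ.≤ n → ℚ.∣ a m ℚ.* b m ℚ.- a n ℚ.* b n ∣ ℚ.≤ ε
      close m n N≤m N≤n = begin
        ℚ.∣ a m ℚ.* b m ℚ.- a n ℚ.* b n ∣
          ≡⟨ cong ℚ.∣_∣ (regroup (a m) (b m) (a n) (b n)) ⟩
        ℚ.∣ a m ℚ.* (b m ℚ.- b n) ℚ.+ b n ℚ.* (a m ℚ.- a n) ∣
          ≤⟨ ℚ.∣p+q∣≤∣p∣+∣q∣ (a m ℚ.* (b m ℚ.- b n)) (b n ℚ.* (a m ℚ.- a n)) ⟩
        ℚ.∣ a m ℚ.* (b m ℚ.- b n) ∣ ℚ.+ ℚ.∣ b n ℚ.* (a m ℚ.- a n) ∣
          ≡⟨ cong₂ ℚ._+_ (ℚ.∣p*q∣≡∣p∣*∣q∣ (a m) (b m ℚ.- b n)) (ℚ.∣p*q∣≡∣p∣*∣q∣ (b n) (a m ℚ.- a n)) ⟩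
        ℚ.∣ a m ∣ ℚ.* ℚ.∣ b m ℚ.- b n ∣ ℚ.+ ℚ.∣ b n ∣ ℚ.* ℚ.∣ a m ℚ.- a n ∣
          ≤⟨ ℚ.+-mono-≤
               (*-mono-≤ (ℚ.0≤∣p∣ (b m ℚ.- b n)) (ℚ.<⇒≤ 0<A)
                 (|a|≤A m (ℕ.m⊔n≤o⇒m≤o K L KL≤m)) (proj₂ (cb δ 0<δ) m n Nb≤m Nb≤n))
               (*-mono-≤ (ℚ.0≤∣p∣ (a m ℚ.- a n)) (ℚ.<⇒≤ 0<B)
                 (|b|≤B n (ℕ.m⊔n≤o⇒n≤o K L KL≤n)) (proj₂ (ca δ 0<δ) m n Na≤m Na≤n)) ⟩
        A ℚ.* δ ℚ.+ B ℚ.* δ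
          ≡⟨ collect ⟩
        ε ∎
        where
        KL≤m : K ℕ.⊔ L ℕ.≤ m
        KL≤m = ℕ.m⊔n≤o⇒m≤o (K ℕ.⊔ L) (Na ℕ.⊔ Nb) N≤m
        KL≤n : K ℕ.⊔ L ℕ.≤ n
        KL≤n = ℕ.m⊔n≤o⇒m≤o (K ℕ.⊔ L) (Na ℕ.⊔ Nb) N≤n
        NN≤m : Na ℕ.⊔ Nb ℕ.≤ m
        NN≤m = ℕ.m⊔n≤o⇒n≤o (K ℕ.⊔ L) (Na ℕ.⊔ Nb) N≤m
        NN≤n : Na ℕ.⊔ Nb ℕ.≤ n
        NN≤n = ℕ.m⊔n≤o⇒n≤o (K ℕ.⊔ L) (Na ℕ.⊔ Nb) N≤n
        Na≤m : Na ℕ.≤ m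
        Na≤m = ℕ.m⊔n≤o⇒m≤o Na Nb NN≤m
        Na≤n : Na ℕ.≤ n
        Na≤n = ℕ.m⊔n≤o⇒m≤o Na Nb NN≤n
        Nb≤m : Nb ℕ.≤ m
        Nb≤m = ℕ.m⊔n≤o⇒n≤o Na Nb NN≤m
        Nb≤n : Nb ℕ.≤ n
        Nb≤n = ℕ.m⊔n≤o⇒n≤o Na Nb NN≤n

    *-cauchy : ∀ {a b} → IsCauchy a → IsCauchy b → IsCauchy (λ n → a n ℚ.* b n)
    *-cauchy {a} {b} ca cb =
      let A , 0<A , |a|≤A = bounded {a} ca
          B , 0<B , |b|≤B = bounded {b} cb
      in *-cauchy′ {a} {b} 0<A |a|≤A 0<B |b|≤B ca cb

    ⊔-pos : ∀ {ε} q → 0ℚ ℚ.< ε → 0ℚ ℚ.< ε ℚ.⊔ q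
    ⊔-pos {ε} q 0<ε = ℚ.<-≤-trans 0<ε (ℚ.p≤p⊔q ε q)

    inverse-cauchy : ∀ {a} ε (0<ε : 0ℚ ℚ.< ε) → ∀ N → (∀ n → N ℕ.≤ n → ε ℚ.≤ a n) → IsCauchy a →
                     IsCauchy (λ n → inverse (ε ℚ.⊔ a n) (⊔-pos (a n) 0<ε))
    inverse-cauchy {a} ε 0<ε N ε≤a ca η 0<η = N ℕ.⊔ M , close
      where
      open ℚ.≤-Reasoning
      δ : ℚ
      δ = (ε ℚ.* ε) ℚ.* η
      0<δ : 0ℚ ℚ.< δ
      0<δ = *-pos (*-pos 0<ε 0<ε) 0<η
      M : ℕ
      M = proj₁ (ca δ 0<δ)
      b j : ℕ → ℚ
      b n = ε ℚ.⊔ a n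
      j n = inverse (b n) (⊔-pos (a n) 0<ε)
      0≤j : ∀ n → 0ℚ ℚ.≤ j n
      0≤j n = ℚ.<⇒≤ (inverse-pos (b n) (⊔-pos (a n) 0<ε))
      0≤jε : ∀ n → 0ℚ ℚ.≤ j n ℚ.* ε
      0≤jε n = ℚ.<⇒≤ (*-pos (inverse-pos (b n) (⊔-pos (a n) 0<ε)) 0<ε)
      jb≡1 : ∀ n → j n ℚ.* b n ≡ 1ℚ
      jb≡1 n = inverse-* (b n) (⊔-pos (a n) 0<ε)
      jε≤1 : ∀ n → j n ℚ.* ε ℚ.≤ 1ℚ
      jε≤1 n = subst (j n ℚ.* ε ℚ.≤_) (jb≡1 n)
        (ℚ.*-monoˡ-≤-nonNeg (j n) {{ℚ.nonNegative (0≤j n)}} (ℚ.p≤p⊔q ε (a n)))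
      b≡a : ∀ n → N ℕ.≤ n → b n ≡ a n
      b≡a n N≤n = ℚ.p≤q⇒p⊔q≡q (ε≤a n N≤n)
      factor : ∀ x y u v → x ℚ.* (y ℚ.* u) ℚ.- y ℚ.* (x ℚ.* v) ≡ (x ℚ.* y) ℚ.* (u ℚ.- v)
      factor = solve 4 (λ x y u v → x :* (y :* u) :- y :* (x :* v) := (x :* y) :* (u :- v)) refl
      regroup : ∀ x y e h → (x ℚ.* y) ℚ.* ((e ℚ.* e) ℚ.* h) ≡ ((x ℚ.* e) ℚ.* (y ℚ.* e)) ℚ.* h
      regroup = solve 4 (λ x y e h → (x :* y) :* ((e :* e) :* h) := ((x :* e) :* (y :* e)) :* h) refl
      difference : ∀ m n → j m ℚ.- j n ≡ (j m ℚ.* j n) ℚ.* (b n ℚ.- b m)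
      difference m n = begin-equality
        j m ℚ.- j n                                             ≡⟨ cong₂ ℚ._-_ (ℚ.*-identityʳ (j m)) (ℚ.*-identityʳ (j n)) ⟨
        j m ℚ.* 1ℚ ℚ.- j n ℚ.* 1ℚ                               ≡⟨ cong₂ (λ u v → j m ℚ.* u ℚ.- j n ℚ.* v) (jb≡1 n) (jb≡1 m) ⟨
        j m ℚ.* (j n ℚ.* b n) ℚ.- j n ℚ.* (j m ℚ.* b m)         ≡⟨ factor (j m) (j n) (b n) (b m) ⟩
        (j m ℚ.* j n) ℚ.* (b n ℚ.- b m)                         ∎
      close : ∀ m n → N ℕ.⊔ M ℕ.≤ m → N ℕ.⊔ M ℕ.≤ n → ℚ.∣ j m ℚ.- j n ∣ ℚ.≤ η
      close m n N≤m N≤n = begin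
        ℚ.∣ j m ℚ.- j n ∣                              ≡⟨ cong ℚ.∣_∣ (difference m n) ⟩
        ℚ.∣ (j m ℚ.* j n) ℚ.* (b n ℚ.- b m) ∣          ≡⟨ ℚ.∣p*q∣≡∣p∣*∣q∣ (j m ℚ.* j n) (b n ℚ.- b m) ⟩
        ℚ.∣ j m ℚ.* j n ∣ ℚ.* ℚ.∣ b n ℚ.- b m ∣        ≡⟨ cong₂ ℚ._*_ (ℚ.0≤p⇒∣p∣≡p 0≤jj)
                                                            (cong₂ (λ u v → ℚ.∣ u ℚ.- v ∣)
                                                              (b≡a n (ℕ.m⊔n≤o⇒m≤o N M N≤n))
                                                              (b≡a m (ℕ.m⊔n≤o⇒m≤o N M N≤m))) ⟩
        (j m ℚ.* j n) ℚ.* ℚ.∣ a n ℚ.- a m ∣            ≤⟨ ℚ.*-monoˡ-≤-nonNeg (j m ℚ.* j n) {{ℚ.nonNegative 0≤jj}}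
                                                            (proj₂ (ca δ 0<δ) n m (ℕ.m⊔n≤o⇒n≤o N M N≤n) (ℕ.m⊔n≤o⇒n≤o N M N≤m)) ⟩
        (j m ℚ.* j n) ℚ.* δ                            ≡⟨ regroup (j m) (j n) ε η ⟩
        ((j m ℚ.* ε) ℚ.* (j n ℚ.* ε)) ℚ.* η            ≤⟨ ℚ.*-monoʳ-≤-nonNeg η {{ℚ.nonNegative (ℚ.<⇒≤ 0<η)}}
                                                            (*-mono-≤ (0≤jε n) (ℚ.<⇒≤ 0<1) (jε≤1 m) (jε≤1 n)) ⟩
        (1ℚ ℚ.* 1ℚ) ℚ.* η                              ≡⟨ ℚ.*-identityˡ η ⟩
        η                                              ∎
        where
        0≤jj : 0ℚ ℚ.≤ j m ℚ.* j n
        0≤jj = ℚ.<⇒≤ (*-pos (inverse-pos (b m) (⊔-pos (a m) 0<ε)) (inverse-pos (b n) (⊔-pos (a n) 0<ε)))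

fromℚ : ℚ → ℝ
fromℚ q = mkℝ (λ _ → q) λ ε 0<ε → 0 , λ _ _ _ _ →
  subst (λ d → ℚ.∣ d ∣ ℚ.≤ ε) (sym (ℚ.+-inverseʳ q)) (ℚ.<⇒≤ 0<ε)

fromℕ : ℕ → ℝ
fromℕ n = fromℚ (ℤ.+ n ℚ./ 1)

0ℝ 1ℝ 2ℝ ½ℝ : ℝ
0ℝ = fromℚ 0ℚ
1ℝ = fromℚ 1ℚ
2ℝ = fromℕ 2
½ℝ = fromℚ ½

_+_ _*_ : ℝ → ℝ → ℝ
x + y = mkℝ (λ n → seq x n ℚ.+ seq y n) (+-cauchy {seq x} {seq y} (cauchy x) (cauchy y))
x * y = mkℝ (λ n → seq x n ℚ.* seq y n) (*-cauchy {seq x} {seq y} (cauchy x) (cauchy y))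

-_ : ℝ → ℝ
- x = mkℝ (λ n → ℚ.- seq x n) (neg-cauchy {seq x} (cauchy x))

_-_ : ℝ → ℝ → ℝ
x - y = x + (- y)

_^_ : ℝ → ℕ → ℝ
x ^ zero  = 1ℝ
x ^ suc n = x * x ^ n

-- The positivity witness supplies ε > 0 with ε ≤ xₙ for all large n, so
-- 1 / (ε ⊔ xₙ) is defined for all n and equal to 1 / xₙ for all large n.
recip : (x : ℝ) → 0ℝ < x → ℝ
recip x (*<* (ε , 0<ε , N , ε≤x)) = mkℝ
  (λ n → inverse (ε ℚ.⊔ seq x n) (⊔-pos (seq x n) 0<ε))
  (inverse-cauchy {seq x} ε 0<ε N (λ n N≤n → subst (ℚ._≤ seq x n) (ℚ.+-identityˡ ε) (ε≤x n N≤n)) (cauchy x))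

1<⇒0< : ∀ {x} → 1ℝ < x → 0ℝ < x
1<⇒0< (*<* (ε , 0<ε , N , 1+ε≤x)) = *<* (ε , 0<ε , N , λ n N≤n →
  ℚ.≤-trans (ℚ.+-monoˡ-≤ ε (ℚ.<⇒≤ 0<1)) (1+ε≤x n N≤n))

-- Coefficients are listed from the constant term upwards.
eval : List ℝ → ℝ → ℝ
eval as x = foldr (λ a v → a + x * v) 0ℝ as

-- The universe is Fin n; a family is given by its characteristic function.
Family : ℕ → Set
Family n = Subset n → Bool

Nonempty : ∀ {n} → Family n → Set
Nonempty F = ∃ λ S → T (F S)

HasExtension : ∀ {n} → Family n → Subset n → ℕ → Set
HasExtension F X ℓ = ∃ λ S → T (F (X ∪ S)) × ∣ S ∣ ℕ.≤ ℓ

-- Successive queries, including repetitions of the same query, are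
-- answered independently; probYes X ℓ is the probability of a yes.
record ExactOracle {n} (F : Family n) : Set where
  field
    probYes  : Subset n → ℕ → ℝ
    0≤prob   : ∀ X ℓ → 0ℝ ≤ probYes X ℓ
    prob≤1   : ∀ X ℓ → probYes X ℓ ≤ 1ℝ
    complete : ∀ X ℓ → HasExtension F X ℓ → ½ℝ ≤ probYes X ℓ
    sound    : ∀ X ℓ → ¬ HasExtension F X ℓ → probYes X ℓ ≈ 0ℝ

open ExactOracle public

-- Randomized oracle algorithms, as arbitrary transition systems.  They
-- need not halt, and are given the universe (n) but not the family.

data Action (n : ℕ) (State : Set) : Set where
  halt    : Bool → Action n State
  compute : State → Action n State
  -- A uniformly random choice among suc k alternatives.
  random  : (k : ℕ) → (Fin (suc k) → State) → Action n State
  query   : Subset n → ℕ → (Bool → State) → Action n State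

record Algorithm : Set₁ where
  field
    State : ℕ → Set
    init  : ∀ n → State n
    step  : ∀ {n} → State n → Action n (State n)

module _ (A : Algorithm) where

  open Algorithm A

  module _ {n : ℕ} {F : Family n} (O : ExactOracle F) where

    infix 4 _⟶_

    -- The transitions of positive probability.
    data _⟶_ (s : State n) : State n → Set where
      compute : ∀ {s′} → step s ≡ compute s′ → s ⟶ s′
      random  : ∀ {k f} → step s ≡ random k f → ∀ i → s ⟶ f i
      yes     : ∀ {X ℓ f} → step s ≡ query X ℓ f → 0ℝ < probYes O X ℓ → s ⟶ f true
      no      : ∀ {X ℓ f} → step s ≡ query X ℓ f → probYes O X ℓ < 1ℝ → s ⟶ f false

    -- Every execution from s halts and returns b.
    data AlwaysReturns (b : Bool) (s : State n) : Set where
      now   : step s ≡ halt b → AlwaysReturns b s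
      later : (∀ b′ → step s ≢ halt b′) → (∀ {s′} → s ⟶ s′ → AlwaysReturns b s′) →
              AlwaysReturns b s

    -- The probability that b is returned from s, observing t actions
    -- (the halting one included).
    returnProb : ℕ → Bool → State n → ℝ
    returnProb zero    b s = 0ℝ
    returnProb (suc t) b s with step s
    ... | halt b′     = if does (b′ Bool.≟ b) then 1ℝ else 0ℝ
    ... | compute s′  = returnProb t b s′
    ... | random k f  = fromℚ (ℤ.+ 1 ℚ./ suc k) * Vector.foldr _+_ 0ℝ (λ i → returnProb t b (f i))
    ... | query X ℓ f = probYes O X ℓ * returnProb t b (f true)
                      + (1ℝ - probYes O X ℓ) * returnProb t b (f false)

    -- The probability of returning b is the supremum over t of
    -- returnProb t b, hence the slack ε.
    ReturnsWithProb≥ : ℝ → Bool → State n → Set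
    ReturnsWithProb≥ q b s = ∀ ε → 0ℝ < ε → ∃ λ t → q ≤ returnProb t b s + ε

    module _ (c : ℝ) where

      infixr 5 _∷_

      stepCost : State n → ℝ
      stepCost s with step s
      ... | halt _      = 0ℝ
      ... | compute _   = 1ℝ
      ... | random _ _  = 1ℝ
      ... | query _ ℓ _ = c ^ ℓ

      -- Executions from s, complete or cut off at any point, indexed by
      -- their cost.  As costs are nonnegative, including the partial ones
      -- does not change the supremum, and it is infinite if some
      -- execution does not halt.
      data Execution (s : State n) : ℝ → Set where
        []  : Execution s 0ℝ
        _∷_ : ∀ {s′ x} → s ⟶ s′ → Execution s′ x → Execution s (stepCost s + x)

  SolvesDEC : Set
  SolvesDEC = ∀ {n} (F : Family n) (O : ExactOracle F) →
    (Nonempty F → ReturnsWithProb≥ O ½ℝ true (init n)) ×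
    (¬ Nonempty F → AlwaysReturns O false (init n))

  -- cost(n) ≥ h, where cost(n) is the supremum, possibly infinite, of the
  -- costs of executions on universes of size at most n.
  CostAtLeast : ℝ → ℕ → ℝ → Set
  CostAtLeast c n h = ∀ B →
    (∀ {m} → m ℕ.≤ n → (F : Family m) (O : ExactOracle F) →
      ∀ {x} → Execution O c (init m) x → x ≤ B) →
    h ≤ B

{-# OPTIONS --safe #-}
module Submission where

-- Put q = 1 - 1/c and give T ⊆ U the weight q ^ (n - |T|), so that the total
-- weight is (1 + q) ^ n = (2 - 1/c) ^ n.  The deterministic oracle for {T}
-- differs from the one for ∅ only on the queries (X , ℓ) with X ⊆ T and
-- |T \ X| ≤ ℓ, and by induction on X these T have weight at most c ^ ℓ, the
-- cost of the query.  Hence the weighted sum over T of the probabilities of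
-- answering yes on {T} is at most the cost of the worst execution on ∅, which
-- must always answer no; on the other hand that sum is at least half of the
-- total weight.  So the polynomial can be taken to be the constant 2.

open import Defs
open import Data.Bool.Base using (Bool; true; false; T; if_then_else_)
open import Data.Bool.Properties as Bool using (T-≡)
open import Data.Empty using (⊥-elim)
open import Data.Fin.Base using (Fin; zero; suc)
open import Data.Fin.Subset using (Subset; inside; outside; _∪_; ∣_∣)
import Data.Integer.Base as ℤ
import Data.Integer.Properties as ℤ
open import Data.List.Base using (List; []; _∷_)
open import Data.Nat.Base as ℕ using (ℕ; zero; suc; z≤n; s≤s)
import Data.Nat.Properties as ℕ
open import Data.Product.Base using (Σ; Σ-syntax; ∃; _×_; _,_; proj₁; proj₂)
open import Data.Rational.Base as ℚ using (ℚ; 0ℚ; 1ℚ; ½)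
import Data.Rational.Properties as ℚ
import Data.Rational.Unnormalised.Base as ℚᵘ
import Data.Rational.Unnormalised.Properties as ℚᵘ
open import Data.Rational.Solver using (module +-*-Solver)
open import Data.Vec.Base using ([]; _∷_)
import Data.Vec.Functional as Vector
open import Data.Vec.Properties using (≡-dec)
open import Function.Base using (_∘_)
open import Function.Bundles using (Equivalence)
open import Relation.Binary.Bundles using (Preorder)
open import Relation.Binary.PropositionalEquality using (_≡_; refl; sym; trans; cong; cong₂; subst)
import Relation.Binary.Reasoning.Preorder as PreorderReasoning
open import Relation.Nullary.Decidable as Dec using (does; dec-true)
open import Relation.Nullary.Negation.Core using (¬_)

open +-*-Solver using (solve; _:+_; _:*_; _:-_; _:=_; con)

-- Real numbers

infix 4 _≐_

-- Unlike _≈_, this relation is a congruence for _*_ without boundedness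
-- arguments, and it already holds between the two sides of a ring identity.
record _≐_ (x y : ℝ) : Set where
  constructor pointwise
  field
    seq-≡ : ∀ n → seq x n ≡ seq y n

open _≐_

≐-refl : ∀ {x} → x ≐ x
≐-refl = pointwise λ _ → refl

≐-reflexive : ∀ {x y} → x ≡ y → x ≐ y
≐-reflexive refl = ≐-refl

≐-sym : ∀ {x y} → x ≐ y → y ≐ x
≐-sym p = pointwise λ n → sym (seq-≡ p n)

≐-trans : ∀ {x y z} → x ≐ y → y ≐ z → x ≐ z
≐-trans p q = pointwise λ n → trans (seq-≡ p n) (seq-≡ q n)

+-cong : ∀ {x y u v} → x ≐ y → u ≐ v → x + u ≐ y + v
+-cong p q = pointwise λ n → cong₂ ℚ._+_ (seq-≡ p n) (seq-≡ q n)

*-cong : ∀ {x y u v} → x ≐ y → u ≐ v → x * u ≐ y * v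
*-cong p q = pointwise λ n → cong₂ ℚ._*_ (seq-≡ p n) (seq-≡ q n)

+-identityˡ : ∀ x → 0ℝ + x ≐ x
+-identityˡ x = pointwise λ n → ℚ.+-identityˡ (seq x n)

*-zeroˡ : ∀ x → 0ℝ * x ≐ 0ℝ
*-zeroˡ x = pointwise λ n → ℚ.*-zeroˡ (seq x n)

*-zeroʳ : ∀ x → x * 0ℝ ≐ 0ℝ
*-zeroʳ x = pointwise λ n → ℚ.*-zeroʳ (seq x n)

*-identityʳ : ∀ x → x * 1ℝ ≐ x
*-identityʳ x = pointwise λ n → ℚ.*-identityʳ (seq x n)

0<1 : 0ℚ ℚ.< 1ℚ
0<1 = ℚ.positive⁻¹ 1ℚ

0≤1 : 0ℚ ℚ.≤ 1ℚ
0≤1 = ℚ.<⇒≤ 0<1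

p≤p+ε : ∀ p {ε} → 0ℚ ℚ.< ε → p ℚ.≤ p ℚ.+ ε
p≤p+ε p {ε} 0<ε = subst (ℚ._≤ p ℚ.+ ε) (ℚ.+-identityʳ p) (ℚ.+-monoʳ-≤ p (ℚ.<⇒≤ 0<ε))

half-pos : ∀ {ε} → 0ℚ ℚ.< ε → 0ℚ ℚ.< ½ ℚ.* ε
half-pos 0<ε = ℚ.*-monoʳ-<-pos ½ 0<ε

eventually-≤ : ∀ {x y} N → (∀ n → N ℕ.≤ n → seq x n ℚ.≤ seq y n) → x ≤ y
eventually-≤ {y = y} N p = *≤* λ ε 0<ε → N , λ n N≤n → ℚ.≤-trans (p n N≤n) (p≤p+ε (seq y n) 0<ε)

≐⇒≤ : ∀ {x y} → x ≐ y → x ≤ y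
≐⇒≤ p = eventually-≤ 0 λ n _ → ℚ.≤-reflexive (seq-≡ p n)

≤-refl : ∀ {x} → x ≤ x
≤-refl = ≐⇒≤ ≐-refl

≤-trans : ∀ {x y z} → x ≤ y → y ≤ z → x ≤ z
≤-trans {x} {y} {z} (*≤* p) (*≤* q) = *≤* λ ε 0<ε →
  let N , x≤y = p (½ ℚ.* ε) (half-pos 0<ε)
      M , y≤z = q (½ ℚ.* ε) (half-pos 0<ε)
  in N ℕ.⊔ M , λ n N⊔M≤n → let open ℚ.≤-Reasoning in begin
    seq x n                                    ≤⟨ x≤y n (ℕ.m⊔n≤o⇒m≤o N M N⊔M≤n) ⟩
    seq y n ℚ.+ ½ ℚ.* ε                        ≤⟨ ℚ.+-monoˡ-≤ (½ ℚ.* ε) (y≤z n (ℕ.m⊔n≤o⇒n≤o N M N⊔M≤n)) ⟩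
    (seq z n ℚ.+ ½ ℚ.* ε) ℚ.+ ½ ℚ.* ε          ≡⟨ solve 2 (λ z e → (z :+ con ½ :* e) :+ con ½ :* e := z :+ e) refl (seq z n) ε ⟩
    seq z n ℚ.+ ε                              ∎

+-mono-≤ : ∀ {x y u v} → x ≤ y → u ≤ v → x + u ≤ y + v
+-mono-≤ {x} {y} {u} {v} (*≤* p) (*≤* q) = *≤* λ ε 0<ε →
  let N , x≤y = p (½ ℚ.* ε) (half-pos 0<ε)
      M , u≤v = q (½ ℚ.* ε) (half-pos 0<ε)
  in N ℕ.⊔ M , λ n N⊔M≤n → let open ℚ.≤-Reasoning in begin
    seq x n ℚ.+ seq u n
      ≤⟨ ℚ.+-mono-≤ (x≤y n (ℕ.m⊔n≤o⇒m≤o N M N⊔M≤n)) (u≤v n (ℕ.m⊔n≤o⇒n≤o N M N⊔M≤n)) ⟩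
    (seq y n ℚ.+ ½ ℚ.* ε) ℚ.+ (seq v n ℚ.+ ½ ℚ.* ε)
      ≡⟨ solve 3 (λ y v e → (y :+ con ½ :* e) :+ (v :+ con ½ :* e) := (y :+ v) :+ e) refl (seq y n) (seq v n) ε ⟩
    (seq y n ℚ.+ seq v n) ℚ.+ ε ∎

-- One half of ε goes to the slack in the hypothesis and the other half to the slack built into
-- `_≤_`. Used at the end, because a success probability is a supremum and is only reached up to ε.
≤+ε⇒≤ : ∀ {x y} → (∀ ε → 0ℚ ℚ.< ε → x ≤ y + fromℚ ε) → x ≤ y
≤+ε⇒≤ {x} {y} p = *≤* λ ε 0<ε →
  let N , x≤ = _≤_.close (p (½ ℚ.* ε) (half-pos 0<ε)) (½ ℚ.* ε) (half-pos 0<ε)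
  in N , λ n N≤n → ℚ.≤-trans (x≤ n N≤n) (ℚ.≤-reflexive
       (solve 2 (λ y e → (y :+ con ½ :* e) :+ con ½ :* e := y :+ e) refl (seq y n) ε))

-- The bounds hold termwise from some index on. `0ℝ ≤ x` would still allow slightly negative terms,
-- and multiplying an inequality by x would then require bounds on its two sides.
record InUnitInterval (x : ℝ) : Set where
  constructor inUnitInterval
  field
    threshold : ℕ
    0≤seq     : ∀ n → threshold ℕ.≤ n → 0ℚ ℚ.≤ seq x n
    seq≤1     : ∀ n → threshold ℕ.≤ n → seq x n ℚ.≤ 1ℚ

-- Multiplying by a term of w lying in [0,1] preserves the inequality and does not enlarge its slack
-- ε, so the same index for ε serves.
*-monoˡ-≤ : ∀ {w x y} → InUnitInterval w → x ≤ y → w * x ≤ w * y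
*-monoˡ-≤ {w} {x} {y} (inUnitInterval N 0≤w w≤1) (*≤* p) = *≤* λ ε 0<ε →
  let M , x≤y = p ε 0<ε
  in N ℕ.⊔ M , λ n N⊔M≤n →
    let N≤n = ℕ.m⊔n≤o⇒m≤o N M N⊔M≤n
        instance _ = ℚ.nonNegative (0≤w n N≤n)
                 _ = ℚ.nonNegative (ℚ.<⇒≤ 0<ε)
        open ℚ.≤-Reasoning in begin
    seq w n ℚ.* seq x n                      ≤⟨ ℚ.*-monoˡ-≤-nonNeg (seq w n) (x≤y n (ℕ.m⊔n≤o⇒n≤o N M N⊔M≤n)) ⟩
    seq w n ℚ.* (seq y n ℚ.+ ε)              ≡⟨ ℚ.*-distribˡ-+ (seq w n) (seq y n) ε ⟩
    seq w n ℚ.* seq y n ℚ.+ seq w n ℚ.* ε    ≤⟨ ℚ.+-monoʳ-≤ (seq w n ℚ.* seq y n) (ℚ.*-monoʳ-≤-nonNeg ε (w≤1 n N≤n)) ⟩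
    seq w n ℚ.* seq y n ℚ.+ 1ℚ ℚ.* ε         ≡⟨ cong (seq w n ℚ.* seq y n ℚ.+_) (ℚ.*-identityˡ ε) ⟩
    seq w n ℚ.* seq y n ℚ.+ ε                ∎

inUnitInterval⇒≤1 : ∀ {x} → InUnitInterval x → x ≤ 1ℝ
inUnitInterval⇒≤1 (inUnitInterval N _ x≤1) = eventually-≤ N x≤1

inUnitInterval⇒0≤ : ∀ {x} → InUnitInterval x → 0ℝ ≤ x
inUnitInterval⇒0≤ (inUnitInterval N 0≤x _) = eventually-≤ N 0≤x

1-inUnitInterval : InUnitInterval 1ℝ
1-inUnitInterval = inUnitInterval 0 (λ _ _ → 0≤1) (λ _ _ → ℚ.≤-refl)

*-inUnitInterval : ∀ {x y} → InUnitInterval x → InUnitInterval y → InUnitInterval (x * y)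
*-inUnitInterval {x} {y} (inUnitInterval N 0≤x x≤1) (inUnitInterval M 0≤y y≤1) = inUnitInterval (N ℕ.⊔ M)
  (λ n N⊔M≤n →
    let instance _ = ℚ.nonNegative (0≤x n (ℕ.m⊔n≤o⇒m≤o N M N⊔M≤n))
    in subst (ℚ._≤ seq x n ℚ.* seq y n) (ℚ.*-zeroʳ (seq x n)) (ℚ.*-monoˡ-≤-nonNeg (seq x n) (0≤y n (ℕ.m⊔n≤o⇒n≤o N M N⊔M≤n))))
  (λ n N⊔M≤n →
    let instance _ = ℚ.nonNegative (0≤x n (ℕ.m⊔n≤o⇒m≤o N M N⊔M≤n))
    in ℚ.≤-trans (ℚ.*-monoˡ-≤-nonNeg (seq x n) (y≤1 n (ℕ.m⊔n≤o⇒n≤o N M N⊔M≤n)))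
         (subst (ℚ._≤ 1ℚ) (sym (ℚ.*-identityʳ (seq x n))) (x≤1 n (ℕ.m⊔n≤o⇒m≤o N M N⊔M≤n))))

-- From the index in the positivity witness on, the maximum `ε ⊔ xₙ` inside `recip` is `xₙ` itself,
-- so the inverse is exact term by term and not merely in the limit.
recip-inverse : ∀ x (0<x : 0ℝ < x) → ∃ λ N → ∀ n → N ℕ.≤ n →
                0ℚ ℚ.≤ seq (recip x 0<x) n × seq (recip x 0<x) n ℚ.* seq x n ≡ 1ℚ
recip-inverse x 0<x@(*<* (ε , 0<ε , N , ε≤x)) = N , λ n N≤n →
  let 0<b = ℚ.<-≤-trans 0<ε (ℚ.p≤p⊔q ε (seq x n))
      b≡x = ℚ.p≤q⇒p⊔q≡q (subst (ℚ._≤ seq x n) (ℚ.+-identityˡ ε) (ε≤x n N≤n))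
  in ℚ.<⇒≤ (ℚ.positive⁻¹ _ {{ℚ.1/pos⇒pos (ε ℚ.⊔ seq x n) {{ℚ.positive 0<b}}}})
   , trans (cong (seq (recip x 0<x) n ℚ.*_) (sym b≡x)) (ℚ.*-inverseˡ (ε ℚ.⊔ seq x n) {{ℚ.>-nonZero 0<b}})

-- Normalisation of a fraction is stuck on a variable k, so the equation is moved to unnormalised
-- rationals, where it is a cross-multiplication.
fromℕ-suc : ∀ k → fromℕ (suc k) ≐ 1ℝ + fromℕ k
fromℕ-suc k = pointwise λ _ → ℚ.toℚᵘ-injective (begin-equality
  ℚ.toℚᵘ (ℤ.+ suc k ℚ./ 1)                         ≃⟨ ℚ.toℚᵘ-fromℚᵘ (ℚᵘ.mkℚᵘ (ℤ.+ suc k) 0) ⟩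
  ℚᵘ.mkℚᵘ (ℤ.+ suc k) 0                            ≃⟨ ℚᵘ.*≡* (cong (ℤ._* ℤ.+ 1) (cong (λ i → ℤ.1ℤ ℤ.+ i) (sym (ℤ.*-identityʳ (ℤ.+ k))))) ⟩
  ℚᵘ.1ℚᵘ ℚᵘ.+ ℚᵘ.mkℚᵘ (ℤ.+ k) 0                    ≃⟨ ℚᵘ.+-congʳ ℚᵘ.1ℚᵘ (ℚ.toℚᵘ-fromℚᵘ (ℚᵘ.mkℚᵘ (ℤ.+ k) 0)) ⟨
  ℚᵘ.1ℚᵘ ℚᵘ.+ ℚ.toℚᵘ (ℤ.+ k ℚ./ 1)                 ≃⟨ ℚ.toℚᵘ-homo-+ 1ℚ (ℤ.+ k ℚ./ 1) ⟨
  ℚ.toℚᵘ (1ℚ ℚ.+ (ℤ.+ k ℚ./ 1))                    ∎)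
  where open ℚᵘ.≤-Reasoning

1/n*n≡1 : ∀ k → (ℤ.+ 1 ℚ./ suc k) ℚ.* (ℤ.+ suc k ℚ./ 1) ≡ 1ℚ
1/n*n≡1 k = ℚ.toℚᵘ-injective (begin-equality
  ℚ.toℚᵘ ((ℤ.+ 1 ℚ./ suc k) ℚ.* (ℤ.+ suc k ℚ./ 1))           ≃⟨ ℚ.toℚᵘ-homo-* (ℤ.+ 1 ℚ./ suc k) (ℤ.+ suc k ℚ./ 1) ⟩
  ℚ.toℚᵘ (ℤ.+ 1 ℚ./ suc k) ℚᵘ.* ℚ.toℚᵘ (ℤ.+ suc k ℚ./ 1)     ≃⟨ ℚᵘ.*-cong (ℚ.toℚᵘ-fromℚᵘ (ℚᵘ.mkℚᵘ (ℤ.+ 1) k)) (ℚ.toℚᵘ-fromℚᵘ (ℚᵘ.mkℚᵘ (ℤ.+ suc k) 0)) ⟩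
  ℚᵘ.mkℚᵘ (ℤ.+ 1) k ℚᵘ.* ℚᵘ.mkℚᵘ (ℤ.+ suc k) 0               ≃⟨ ℚᵘ.*-inverseˡ (ℚᵘ.mkℚᵘ (ℤ.+ suc k) 0) ⟩
  ℚᵘ.1ℚᵘ                                                     ∎)
  where open ℚᵘ.≤-Reasoning

≤-preorder : Preorder _ _ _
≤-preorder = record
  { _≈_        = _≐_
  ; _≲_        = _≤_
  ; isPreorder = record
    { isEquivalence = record { refl = ≐-refl ; sym = ≐-sym ; trans = ≐-trans }
    ; reflexive     = ≐⇒≤
    ; trans         = ≤-trans
    }
  }

open PreorderReasoning ≤-preorder

x+y≤z⇒y≤z-x : ∀ {x y z} → x + y ≤ z → y ≤ z - x
x+y≤z⇒y≤z-x {x} {y} {z} p = begin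
  y             ≈⟨ pointwise (λ n → solve 2 (λ x y → y := (x :+ y) :- x) refl (seq x n) (seq y n)) ⟩
  (x + y) - x   ≲⟨ +-mono-≤ p ≤-refl ⟩
  z - x         ∎

y≤z-x⇒x+y≤z : ∀ {x y z} → y ≤ z - x → x + y ≤ z
y≤z-x⇒x+y≤z {x} {y} {z} p = begin
  x + y         ≲⟨ +-mono-≤ ≤-refl p ⟩
  x + (z - x)   ≈⟨ pointwise (λ n → solve 2 (λ x z → x :+ (z :- x) := z) refl (seq x n) (seq z n)) ⟩
  z             ∎

1<⇒1≤seq : ∀ {x} → 1ℝ < x → ∃ λ N → ∀ n → N ℕ.≤ n → 1ℚ ℚ.≤ seq x n
1<⇒1≤seq (*<* (ε , 0<ε , N , 1+ε≤x)) = N , λ n N≤n → ℚ.≤-trans (p≤p+ε 1ℚ 0<ε) (1+ε≤x n N≤n)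

-- Finite averages

sum : ∀ {k} → (Fin k → ℝ) → ℝ
sum = Vector.foldr _+_ 0ℝ

sum-mono-≤ : ∀ {k} {x y : Fin k → ℝ} → (∀ i → x i ≤ y i) → sum x ≤ sum y
sum-mono-≤ {zero}  p = ≤-refl
sum-mono-≤ {suc k} p = +-mono-≤ (p zero) (sum-mono-≤ (p ∘ suc))

sum-const : ∀ k x → sum {k} (λ _ → x) ≐ fromℕ k * x
sum-const zero    x = ≐-sym (*-zeroˡ x)
sum-const (suc k) x = begin-equality
  x + sum {k} (λ _ → x)    ≈⟨ +-cong ≐-refl (sum-const k x) ⟩
  x + fromℕ k * x          ≈⟨ pointwise (λ n → solve 2 (λ m y → y :+ m :* y := (con 1ℚ :+ m) :* y) refl (seq (fromℕ k) n) (seq x n)) ⟩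
  (1ℝ + fromℕ k) * x       ≈⟨ *-cong (fromℕ-suc k) ≐-refl ⟨
  fromℕ (suc k) * x        ∎

sum-* : ∀ {k} a (x : Fin k → ℝ) → a * sum x ≐ sum (λ i → a * x i)
sum-* {zero}  a x = *-zeroʳ a
sum-* {suc k} a x = begin-equality
  a * (x zero + sum (x ∘ suc))                ≈⟨ pointwise (λ n → ℚ.*-distribˡ-+ (seq a n) (seq (x zero) n) (seq (sum (x ∘ suc)) n)) ⟩
  a * x zero + a * sum (x ∘ suc)              ≈⟨ +-cong ≐-refl (sum-* a (x ∘ suc)) ⟩
  a * x zero + sum (λ i → a * x (suc i))      ∎

-- Written to agree definitionally with the `random` clause of `returnProb`.
average : ∀ {k} → (Fin (suc k) → ℝ) → ℝ
average {k} x = fromℚ (ℤ.+ 1 ℚ./ suc k) * sum x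

average-mono-≤ : ∀ {k} {x y : Fin (suc k) → ℝ} → (∀ i → x i ≤ y i) → average x ≤ average y
average-mono-≤ {k} p = *-monoˡ-≤
  (inUnitInterval 0 (λ _ _ → ℚ.nonNegative⁻¹ _ {{ℚ.normalize-nonNeg 1 (suc k)}}) (λ _ _ → 1/n≤1))
  (sum-mono-≤ p)
  where
  1/n≤1 : ℤ.+ 1 ℚ./ suc k ℚ.≤ 1ℚ
  1/n≤1 = ℚ.toℚᵘ-cancel-≤ (ℚᵘ.≤-trans (ℚᵘ.≤-reflexive (ℚ.toℚᵘ-fromℚᵘ (ℚᵘ.mkℚᵘ (ℤ.+ 1) k)))
            (ℚᵘ.*≤* (ℤ.+≤+ (s≤s z≤n))))

average-const : ∀ k x → average {k} (λ _ → x) ≐ x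
average-const k x = begin-equality
  fromℚ 1/n * sum {suc k} (λ _ → x)    ≈⟨ *-cong ≐-refl (sum-const (suc k) x) ⟩
  fromℚ 1/n * (fromℕ (suc k) * x)      ≈⟨ pointwise (λ m → trans (sym (ℚ.*-assoc 1/n (seq (fromℕ (suc k)) m) (seq x m)))
                                            (trans (cong (ℚ._* seq x m) (1/n*n≡1 k)) (ℚ.*-identityˡ (seq x m)))) ⟩
  x                                    ∎
  where
  1/n = ℤ.+ 1 ℚ./ suc k

average-* : ∀ {k} a (x : Fin (suc k) → ℝ) → a * average x ≐ average (λ i → a * x i)
average-* {k} a x = begin-equality
  a * (fromℚ 1/n * sum x)            ≈⟨ pointwise (λ m → solve 3 (λ a u s → a :* (u :* s) := u :* (a :* s)) refl (seq a m) 1/n (seq (sum x) m)) ⟩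
  fromℚ 1/n * (a * sum x)            ≈⟨ *-cong ≐-refl (sum-* a x) ⟩
  fromℚ 1/n * sum (λ i → a * x i)    ∎
  where
  1/n = ℤ.+ 1 ℚ./ suc k

average-≤ : ∀ {k} {x : Fin (suc k) → ℝ} {b} → (∀ i → x i ≤ b) → average x ≤ b
average-≤ {k} {b = b} p = ≤-trans (average-mono-≤ p) (≐⇒≤ (average-const k b))

average-≥ : ∀ {k} {x : Fin (suc k) → ℝ} {b} → (∀ i → b ≤ x i) → b ≤ average x
average-≥ {k} {b = b} p = ≤-trans (≐⇒≤ (≐-sym (average-const k b))) (average-mono-≤ p)

-- Sums over all subsets

-- Splitting on the first element makes `weight` and `covers` reduce on each half of the sum.
sumSubsets : ∀ {n} → (Subset n → ℝ) → ℝ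
sumSubsets {zero}  f = f []
sumSubsets {suc n} f = sumSubsets (λ S → f (outside ∷ S)) + sumSubsets (λ S → f (inside ∷ S))

sumSubsets-cong : ∀ {n} {f g : Subset n → ℝ} → (∀ S → f S ≐ g S) → sumSubsets f ≐ sumSubsets g
sumSubsets-cong {zero}  p = p []
sumSubsets-cong {suc n} p = +-cong (sumSubsets-cong (λ S → p (outside ∷ S))) (sumSubsets-cong (λ S → p (inside ∷ S)))

sumSubsets-mono-≤ : ∀ {n} {f g : Subset n → ℝ} → (∀ S → f S ≤ g S) → sumSubsets f ≤ sumSubsets g
sumSubsets-mono-≤ {zero}  p = p []
sumSubsets-mono-≤ {suc n} p = +-mono-≤ (sumSubsets-mono-≤ (λ S → p (outside ∷ S))) (sumSubsets-mono-≤ (λ S → p (inside ∷ S)))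

sumSubsets-+ : ∀ {n} (f g : Subset n → ℝ) → sumSubsets (λ S → f S + g S) ≐ sumSubsets f + sumSubsets g
sumSubsets-+ {zero}  f g = ≐-refl
sumSubsets-+ {suc n} f g = begin-equality
  sumSubsets (λ S → f₀ S + g₀ S) + sumSubsets (λ S → f₁ S + g₁ S)
    ≈⟨ +-cong (sumSubsets-+ f₀ g₀) (sumSubsets-+ f₁ g₁) ⟩
  (sumSubsets f₀ + sumSubsets g₀) + (sumSubsets f₁ + sumSubsets g₁)
    ≈⟨ pointwise (λ k → solve 4 (λ a b x y → (a :+ x) :+ (b :+ y) := (a :+ b) :+ (x :+ y)) refl
         (seq (sumSubsets f₀) k) (seq (sumSubsets f₁) k) (seq (sumSubsets g₀) k) (seq (sumSubsets g₁) k)) ⟩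
  (sumSubsets f₀ + sumSubsets f₁) + (sumSubsets g₀ + sumSubsets g₁) ∎
  where
  f₀ f₁ g₀ g₁ : Subset n → ℝ
  f₀ S = f (outside ∷ S)
  f₁ S = f (inside ∷ S)
  g₀ S = g (outside ∷ S)
  g₁ S = g (inside ∷ S)

sumSubsets-* : ∀ {n} a (f : Subset n → ℝ) → sumSubsets (λ S → a * f S) ≐ a * sumSubsets f
sumSubsets-* {zero}  a f = ≐-refl
sumSubsets-* {suc n} a f = begin-equality
  sumSubsets (λ S → a * f₀ S) + sumSubsets (λ S → a * f₁ S)  ≈⟨ +-cong (sumSubsets-* a f₀) (sumSubsets-* a f₁) ⟩
  a * sumSubsets f₀ + a * sumSubsets f₁                      ≈⟨ pointwise (λ k → ℚ.*-distribˡ-+ (seq a k) (seq (sumSubsets f₀) k) (seq (sumSubsets f₁) k)) ⟨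
  a * (sumSubsets f₀ + sumSubsets f₁)                        ∎
  where
  f₀ f₁ : Subset n → ℝ
  f₀ S = f (outside ∷ S)
  f₁ S = f (inside ∷ S)

sumSubsets-zero : ∀ {n} {f : Subset n → ℝ} → (∀ S → f S ≐ 0ℝ) → sumSubsets f ≐ 0ℝ
sumSubsets-zero {zero}  p = p []
sumSubsets-zero {suc n} p = ≐-trans
  (+-cong (sumSubsets-zero (λ S → p (outside ∷ S))) (sumSubsets-zero (λ S → p (inside ∷ S))))
  (+-identityˡ 0ℝ)

sumSubsets-sum : ∀ {n k} (g : Fin k → Subset n → ℝ) →
                 sumSubsets (λ S → sum (λ i → g i S)) ≐ sum (λ i → sumSubsets (g i))
sumSubsets-sum {n} {zero}  g = sumSubsets-zero {n} (λ _ → ≐-refl)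
sumSubsets-sum {n} {suc k} g = ≐-trans
  (sumSubsets-+ (g zero) (λ S → sum (λ i → g (suc i) S)))
  (+-cong ≐-refl (sumSubsets-sum (g ∘ suc)))

-- Each S has its own time M. There are finitely many S, so the maximum of these times serves all of
-- them; the slack is halved at each split, so the total is still ε.
sumSubsets-approx : ∀ {n} (f : Subset n → ℝ) (g : ℕ → Subset n → ℝ) →
  (∀ S ε → 0ℚ ℚ.< ε → ∃ λ M → ∀ t → M ℕ.≤ t → f S ≤ g t S + fromℚ ε) →
  ∀ ε → 0ℚ ℚ.< ε → ∃ λ M → ∀ t → M ℕ.≤ t → sumSubsets f ≤ sumSubsets (g t) + fromℚ ε
sumSubsets-approx {zero}  f g p = p []
sumSubsets-approx {suc n} f g p ε 0<ε =
  let M , f₀≤g₀ = sumSubsets-approx f₀ g₀ (λ S → p (outside ∷ S)) (½ ℚ.* ε) (half-pos 0<ε)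
      N , f₁≤g₁ = sumSubsets-approx f₁ g₁ (λ S → p (inside ∷ S)) (½ ℚ.* ε) (half-pos 0<ε)
  in M ℕ.⊔ N , λ t M⊔N≤t → begin
    sumSubsets f₀ + sumSubsets f₁
      ≲⟨ +-mono-≤ (f₀≤g₀ t (ℕ.m⊔n≤o⇒m≤o M N M⊔N≤t)) (f₁≤g₁ t (ℕ.m⊔n≤o⇒n≤o M N M⊔N≤t)) ⟩
    (sumSubsets (g₀ t) + fromℚ (½ ℚ.* ε)) + (sumSubsets (g₁ t) + fromℚ (½ ℚ.* ε))
      ≈⟨ pointwise (λ k → solve 3 (λ y v e → (y :+ con ½ :* e) :+ (v :+ con ½ :* e) := (y :+ v) :+ e) refl
           (seq (sumSubsets (g₀ t)) k) (seq (sumSubsets (g₁ t)) k) ε) ⟩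
    (sumSubsets (g₀ t) + sumSubsets (g₁ t)) + fromℚ ε ∎
  where
  f₀ f₁ : Subset n → ℝ
  f₀ S = f (outside ∷ S)
  f₁ S = f (inside ∷ S)
  g₀ g₁ : ℕ → Subset n → ℝ
  g₀ t S = g t (outside ∷ S)
  g₁ t S = g t (inside ∷ S)

-- Covered sets and their weight

-- Decides whether X ⊆ S and S has at most ℓ elements outside X: each such element uses up one unit
-- of ℓ. This is the exact answer to the query (X , ℓ) on the family {S}.
covers : ∀ {n} → Subset n → ℕ → Subset n → Bool
covers []            ℓ       []            = true
covers (inside ∷ X)  ℓ       (inside ∷ S)  = covers X ℓ S
covers (inside ∷ X)  ℓ       (outside ∷ S) = false
covers (outside ∷ X) ℓ       (outside ∷ S) = covers X ℓ S
covers (outside ∷ X) zero    (inside ∷ S)  = false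
covers (outside ∷ X) (suc ℓ) (inside ∷ S)  = covers X ℓ S

-- The witness is the smallest possible one, the set of elements of S outside X.
covers-sound : ∀ {n} (X : Subset n) ℓ S → covers X ℓ S ≡ true → ∃ λ Y → X ∪ Y ≡ S × ∣ Y ∣ ℕ.≤ ℓ
covers-sound []            ℓ       []            p = [] , refl , z≤n
covers-sound (inside ∷ X)  ℓ       (inside ∷ S)  p =
  let Y , eq , ∣Y∣≤ℓ = covers-sound X ℓ S p in outside ∷ Y , cong (inside ∷_) eq , ∣Y∣≤ℓ
covers-sound (outside ∷ X) ℓ       (outside ∷ S) p =
  let Y , eq , ∣Y∣≤ℓ = covers-sound X ℓ S p in outside ∷ Y , cong (outside ∷_) eq , ∣Y∣≤ℓ
covers-sound (outside ∷ X) (suc ℓ) (inside ∷ S)  p =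
  let Y , eq , ∣Y∣≤ℓ = covers-sound X ℓ S p in inside ∷ Y , cong (inside ∷_) eq , s≤s ∣Y∣≤ℓ

covers-complete : ∀ {n} (X Y : Subset n) ℓ → ∣ Y ∣ ℕ.≤ ℓ → covers X ℓ (X ∪ Y) ≡ true
covers-complete []            []            ℓ       p       = refl
-- An extension may repeat an element of X. It counts towards `∣ Y ∣` but costs `covers` nothing, so
-- the bound is weakened.
covers-complete (inside ∷ X)  (inside ∷ Y)  ℓ       p       = covers-complete X Y ℓ (ℕ.<⇒≤ p)
covers-complete (inside ∷ X)  (outside ∷ Y) ℓ       p       = covers-complete X Y ℓ p
covers-complete (outside ∷ X) (inside ∷ Y)  (suc ℓ) (s≤s p) = covers-complete X Y ℓ p
covers-complete (outside ∷ X) (outside ∷ Y) ℓ       p       = covers-complete X Y ℓ p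

𝟙 : Bool → ℝ
𝟙 b = if b then 1ℝ else 0ℝ

weight : ∀ {n} → ℝ → Subset n → ℝ
weight q []            = 1ℝ
weight q (outside ∷ S) = q * weight q S
weight q (inside ∷ S)  = weight q S

weight-inUnitInterval : ∀ {n q} → InUnitInterval q → (S : Subset n) → InUnitInterval (weight q S)
weight-inUnitInterval u []            = 1-inUnitInterval
weight-inUnitInterval u (outside ∷ S) = *-inUnitInterval u (weight-inUnitInterval u S)
weight-inUnitInterval u (inside ∷ S)  = weight-inUnitInterval u S

-- The binomial theorem: an element left out contributes a factor q, an element taken a factor 1.
sum-weight : ∀ n q → sumSubsets (weight {n} q) ≐ (1ℝ + q) ^ n
sum-weight zero    q = ≐-refl
sum-weight (suc n) q = begin-equality
  sumSubsets {n} (λ S → q * weight q S) + sumSubsets (weight {n} q)   ≈⟨ +-cong (sumSubsets-* {n} q (weight q)) ≐-refl ⟩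
  q * sumSubsets (weight {n} q) + sumSubsets (weight {n} q)       ≈⟨ +-cong (*-cong ≐-refl (sum-weight n q)) (sum-weight n q) ⟩
  q * (1ℝ + q) ^ n + (1ℝ + q) ^ n                                 ≈⟨ pointwise (λ k → solve 2 (λ q p → q :* p :+ p := (con 1ℚ :+ q) :* p) refl (seq q k) (seq ((1ℝ + q) ^ n) k)) ⟩
  (1ℝ + q) * (1ℝ + q) ^ n                                         ∎

^-cong : ∀ {x y} n → x ≐ y → x ^ n ≐ y ^ n
^-cong zero    p = ≐-refl
^-cong (suc n) p = *-cong p (^-cong n p)

-- All that the counting needs to know about q = 1 - 1/c. The last field is the recurrence for the
-- weight of the covered sets, split on an element outside X.
record IsDiscount (c q : ℝ) : Set where
  field
    inUnit         : InUnitInterval q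
    1≤c^           : ∀ ℓ → 1ℝ ≤ c ^ ℓ
    q*c^[1+ℓ]+c^ℓ≤ : ∀ ℓ → q * c ^ suc ℓ + c ^ ℓ ≤ c ^ suc ℓ

1-1/c-isDiscount : ∀ {c} (1<c : 1ℝ < c) → IsDiscount c (1ℝ - recip c (1<⇒0< 1<c))
1-1/c-isDiscount {c} 1<c = record
  { inUnit = inUnitInterval (N ℕ.⊔ M)
      (λ n N⊔M≤n → subst (ℚ._≤ 1ℚ ℚ.- seq r n) (ℚ.+-inverseʳ 1ℚ) (ℚ.+-monoʳ-≤ 1ℚ (ℚ.neg-antimono-≤ (r≤1 n N⊔M≤n))))
      (λ n N⊔M≤n → ℚ.+-monoʳ-≤ 1ℚ (ℚ.neg-antimono-≤ (proj₁ (r-spec n (ℕ.m⊔n≤o⇒m≤o N M N⊔M≤n)))))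
  ; 1≤c^ = λ ℓ → eventually-≤ M λ n M≤n → 1≤c^ n (1≤c n M≤n) ℓ
  ; q*c^[1+ℓ]+c^ℓ≤ = λ ℓ → eventually-≤ N λ n N≤n →
      ℚ.≤-reflexive (telescope (seq r n) (seq c n) (seq (c ^ ℓ) n) (proj₂ (r-spec n N≤n)))
  }
  where
  r = recip c (1<⇒0< 1<c)
  N = proj₁ (recip-inverse c (1<⇒0< 1<c))
  r-spec = proj₂ (recip-inverse c (1<⇒0< 1<c))
  M = proj₁ (1<⇒1≤seq 1<c)
  1≤c = proj₂ (1<⇒1≤seq 1<c)
  -- From r = r · 1 ≤ r · c = 1. This yields 0 ≤ q, while q ≤ 1 comes from 0 ≤ r.
  r≤1 : ∀ n → N ℕ.⊔ M ℕ.≤ n → seq r n ℚ.≤ 1ℚ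
  r≤1 n N⊔M≤n =
    let 0≤r , rc≡1 = r-spec n (ℕ.m⊔n≤o⇒m≤o N M N⊔M≤n)
        instance _ = ℚ.nonNegative 0≤r
    in subst (ℚ._≤ 1ℚ) (ℚ.*-identityʳ (seq r n)) (subst (seq r n ℚ.* 1ℚ ℚ.≤_) rc≡1
         (ℚ.*-monoˡ-≤-nonNeg (seq r n) (1≤c n (ℕ.m⊔n≤o⇒n≤o N M N⊔M≤n))))
  1≤c^ : ∀ n → 1ℚ ℚ.≤ seq c n → ∀ ℓ → 1ℚ ℚ.≤ seq (c ^ ℓ) n
  1≤c^ n 1≤cₙ zero    = ℚ.≤-refl
  1≤c^ n 1≤cₙ (suc ℓ) =
    let instance _ = ℚ.nonNegative (ℚ.≤-trans 0≤1 1≤cₙ)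
    in ℚ.≤-trans 1≤cₙ (subst (ℚ._≤ seq c n ℚ.* seq (c ^ ℓ) n) (ℚ.*-identityʳ (seq c n))
         (ℚ.*-monoˡ-≤-nonNeg (seq c n) (1≤c^ n 1≤cₙ ℓ)))
  -- With z = c ^ ℓ, the term (1/c) · c ^ (1 + ℓ) cancels c ^ ℓ, so the recurrence even holds with
  -- equality.
  telescope : ∀ r c z → r ℚ.* c ≡ 1ℚ → (1ℚ ℚ.- r) ℚ.* (c ℚ.* z) ℚ.+ z ≡ c ℚ.* z
  telescope r c z rc≡1 =
    trans (solve 3 (λ r c z → (con 1ℚ :- r) :* (c :* z) :+ z := (c :* z :+ z) :- (r :* c) :* z) refl r c z)
    (trans (cong (λ u → (c ℚ.* z ℚ.+ z) ℚ.- u ℚ.* z) rc≡1)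
    (solve 2 (λ c z → (c :* z :+ z) :- con 1ℚ :* z := c :* z) refl c z))

module CoveredWeight {c q : ℝ} (isDiscount : IsDiscount c q) where

  open IsDiscount isDiscount

  coveredWeight : ∀ {n} → Subset n → ℕ → ℝ
  coveredWeight X ℓ = sumSubsets (λ S → weight q S * 𝟙 (covers X ℓ S))

  factor-q : ∀ {n} (X : Subset n) ℓ →
    sumSubsets (λ S → (q * weight q S) * 𝟙 (covers X ℓ S)) ≐ q * coveredWeight X ℓ
  factor-q {n} X ℓ = ≐-trans
    (sumSubsets-cong {n} λ S → pointwise λ k → ℚ.*-assoc (seq q k) (seq (weight q S) k) (seq (𝟙 (covers X ℓ S)) k))
    (sumSubsets-* {n} q _)

  -- An element of X must lie in S, so one half of the sum vanishes and the other has factor 1. An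
  -- element outside X is either left out of S, at factor q with ℓ unchanged, or taken, at factor 1
  -- with ℓ reduced by one; the recurrence adds these up to c ^ ℓ. For ℓ = 0 nothing can be taken,
  -- and q ≤ 1 suffices.
  coveredWeight≤c^ : ∀ {n} (X : Subset n) ℓ → coveredWeight X ℓ ≤ c ^ ℓ
  coveredWeight≤c^ []            ℓ = ≤-trans (≐⇒≤ (*-identityʳ 1ℝ)) (1≤c^ ℓ)
  coveredWeight≤c^ {suc n} (inside ∷ X)  ℓ = begin
    sumSubsets {n} (λ S → (q * weight q S) * 0ℝ) + coveredWeight X ℓ  ≈⟨ +-cong (sumSubsets-zero {n} λ S → *-zeroʳ (q * weight q S)) ≐-refl ⟩
    0ℝ + coveredWeight X ℓ                                        ≈⟨ +-identityˡ _ ⟩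
    coveredWeight X ℓ                                             ≲⟨ coveredWeight≤c^ X ℓ ⟩
    c ^ ℓ                                                         ∎
  coveredWeight≤c^ {suc n} (outside ∷ X) zero = begin
    sumSubsets {n} (λ S → (q * weight q S) * 𝟙 (covers X 0 S)) + sumSubsets {n} (λ S → weight q S * 0ℝ)
      ≈⟨ +-cong (factor-q X 0) (sumSubsets-zero {n} λ S → *-zeroʳ (weight q S)) ⟩
    q * coveredWeight X 0 + 0ℝ
      ≲⟨ +-mono-≤ (*-monoˡ-≤ inUnit (coveredWeight≤c^ X 0)) ≤-refl ⟩
    q * 1ℝ + 0ℝ
      ≈⟨ pointwise (λ k → solve 1 (λ q → q :* con 1ℚ :+ con 0ℚ := q) refl (seq q k)) ⟩
    q
      ≲⟨ inUnitInterval⇒≤1 inUnit ⟩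
    1ℝ ∎
  coveredWeight≤c^ {suc n} (outside ∷ X) (suc ℓ) = begin
    sumSubsets {n} (λ S → (q * weight q S) * 𝟙 (covers X (suc ℓ) S)) + coveredWeight X ℓ
      ≈⟨ +-cong (factor-q X (suc ℓ)) ≐-refl ⟩
    q * coveredWeight X (suc ℓ) + coveredWeight X ℓ
      ≲⟨ +-mono-≤ (*-monoˡ-≤ inUnit (coveredWeight≤c^ X (suc ℓ))) (coveredWeight≤c^ X ℓ) ⟩
    q * c ^ suc ℓ + c ^ ℓ
      ≲⟨ q*c^[1+ℓ]+c^ℓ≤ ℓ ⟩
    c ^ suc ℓ ∎

-- The oracles for ∅ and for singletons

∅ : ∀ {n} → Family n
∅ _ = false

∅-oracle : ∀ {n} → ExactOracle {n} ∅
∅-oracle = record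
  { probYes  = λ _ _ → 0ℝ
  ; 0≤prob   = λ _ _ → ≤-refl
  ; prob≤1   = λ _ _ → inUnitInterval⇒0≤ 1-inUnitInterval
  ; complete = λ { _ _ (_ , () , _) }
  ; sound    = λ _ _ _ → ≤-refl , ≤-refl
  }

singleton : ∀ {n} → Subset n → Family n
singleton S X = does (≡-dec Bool._≟_ X S)

∈-singleton⁺ : ∀ {n} {X S : Subset n} → X ≡ S → T (singleton S X)
∈-singleton⁺ {X = X} {S} eq = Equivalence.from T-≡ (dec-true (≡-dec Bool._≟_ X S) eq)

∈-singleton⁻ : ∀ {n} {X S : Subset n} → T (singleton S X) → X ≡ S
∈-singleton⁻ {X = X} {S} p with ≡-dec Bool._≟_ X S
... | Dec.yes eq = eq

0≤𝟙 : ∀ b → 0ℝ ≤ 𝟙 b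
0≤𝟙 true  = inUnitInterval⇒0≤ 1-inUnitInterval
0≤𝟙 false = ≤-refl

𝟙≤1 : ∀ b → 𝟙 b ≤ 1ℝ
𝟙≤1 true  = ≤-refl
𝟙≤1 false = inUnitInterval⇒0≤ 1-inUnitInterval

singletonOracle : ∀ {n} (S : Subset n) → ExactOracle (singleton S)
singletonOracle S = record
  { probYes  = λ X ℓ → 𝟙 (covers X ℓ S)
  ; 0≤prob   = λ X ℓ → 0≤𝟙 (covers X ℓ S)
  ; prob≤1   = λ X ℓ → 𝟙≤1 (covers X ℓ S)
  ; complete = λ X ℓ → λ { (Y , p , ∣Y∣≤ℓ) →
      subst (λ b → ½ℝ ≤ 𝟙 b)
        (sym (subst (λ S → covers X ℓ S ≡ true) (∈-singleton⁻ p) (covers-complete X Y ℓ ∣Y∣≤ℓ)))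
        (eventually-≤ 0 λ _ _ → ℚ.*≤* (ℤ.+≤+ (s≤s z≤n))) }
  ; sound    = λ X ℓ ¬ext → none X ℓ ¬ext (covers X ℓ S) refl
  }
  where
  none : ∀ X ℓ → ¬ HasExtension (singleton S) X ℓ → ∀ b → covers X ℓ S ≡ b → 𝟙 b ≈ 0ℝ
  none X ℓ ¬ext false eq = ≤-refl , ≤-refl
  none X ℓ ¬ext true  eq =
    let Y , X∪Y≡S , ∣Y∣≤ℓ = covers-sound X ℓ S eq
    in ⊥-elim (¬ext (Y , ∈-singleton⁺ X∪Y≡S , ∣Y∣≤ℓ))

-- The singleton oracles answer with probability 0 or 1, so a query selects a branch instead of
-- mixing two. Bounds on queries then follow by cases.
𝟙-select : ∀ b u v → 𝟙 b * u + (1ℝ - 𝟙 b) * v ≐ (if b then u else v)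
𝟙-select true  u v = pointwise λ k → solve 2 (λ u v → con 1ℚ :* u :+ (con 1ℚ :- con 1ℚ) :* v := u) refl (seq u k) (seq v k)
𝟙-select false u v = pointwise λ k → solve 2 (λ u v → con 0ℚ :* u :+ (con 1ℚ :- con 0ℚ) :* v := v) refl (seq u k) (seq v k)

-- Executions

halt-injective : ∀ {n} {State : Set} {b b′ : Bool} → halt {n} {State} b ≡ halt b′ → b ≡ b′
halt-injective refl = refl

module _ (A : Algorithm) where

  open Algorithm A

  module _ {n : ℕ} {F : Family n} {O : ExactOracle F} where

    halt-result : ∀ {b b′ s} → AlwaysReturns A O b s → step s ≡ halt b′ → b′ ≡ b
    halt-result (now eq)       eq′ = halt-injective (trans (sym eq′) eq)
    halt-result (later ¬halt _) eq′ = ⊥-elim (¬halt _ eq′)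

    alwaysReturns-step : ∀ {b s s′} → AlwaysReturns A O b s → _⟶_ A O s s′ → AlwaysReturns A O b s′
    alwaysReturns-step (later _ next) s⟶s′ = next s⟶s′
    alwaysReturns-step (now eq) (compute eq′)  with () ← trans (sym eq) eq′
    alwaysReturns-step (now eq) (random eq′ _) with () ← trans (sym eq) eq′
    alwaysReturns-step (now eq) (yes eq′ _)    with () ← trans (sym eq) eq′
    alwaysReturns-step (now eq) (no eq′ _)     with () ← trans (sym eq) eq′

  module _ {n : ℕ} {F : Family n} (O : ExactOracle F) {s : State n} where

    -- `step s` does not depend on the oracle. With these unfolding equations, one case distinction
    -- on it serves the oracles of all singletons and that of ∅ at once.
    returnProb-halt : ∀ {b b′ t} → step s ≡ halt b′ → returnProb A O (suc t) b s ≡ 𝟙 (does (b′ Bool.≟ b))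
    returnProb-halt eq rewrite eq = refl

    returnProb-compute : ∀ {b t s′} → step s ≡ compute s′ → returnProb A O (suc t) b s ≡ returnProb A O t b s′
    returnProb-compute eq rewrite eq = refl

    returnProb-random : ∀ {b t k f} → step s ≡ random k f →
                        returnProb A O (suc t) b s ≡ average (λ i → returnProb A O t b (f i))
    returnProb-random eq rewrite eq = refl

    returnProb-query : ∀ {b t X ℓ f} → step s ≡ query X ℓ f →
                       returnProb A O (suc t) b s ≡ probYes O X ℓ * returnProb A O t b (f true) +
                                                    (1ℝ - probYes O X ℓ) * returnProb A O t b (f false)
    returnProb-query eq rewrite eq = refl

    stepCost-compute : ∀ {c s′} → step s ≡ compute s′ → stepCost A O c s ≡ 1ℝ
    stepCost-compute eq rewrite eq = refl

    stepCost-random : ∀ {c k f} → step s ≡ random k f → stepCost A O c s ≡ 1ℝ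
    stepCost-random eq rewrite eq = refl

    stepCost-query : ∀ {c X ℓ f} → step s ≡ query X ℓ f → stepCost A O c s ≡ c ^ ℓ
    stepCost-query eq rewrite eq = refl

  -- Return probabilities on a singleton family

  module _ {n : ℕ} (S : Subset n) where

    private
      prob : ℕ → Bool → State n → ℝ
      prob = returnProb A (singletonOracle S)

    returnProb≥0 : ∀ t b s → 0ℝ ≤ prob t b s
    returnProb≥0 zero    b s = ≤-refl
    returnProb≥0 (suc t) b s with step s
    ... | halt b′     = 0≤𝟙 (does (b′ Bool.≟ b))
    ... | compute s′  = returnProb≥0 t b s′
    ... | random k f  = average-≥ (λ i → returnProb≥0 t b (f i))
    ... | query X ℓ f = begin
      0ℝ                                                         ≲⟨ select (covers X ℓ S) ⟩
      (if covers X ℓ S then prob t b (f true) else prob t b (f false)) ≈⟨ 𝟙-select (covers X ℓ S) _ _ ⟨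
      𝟙 (covers X ℓ S) * prob t b (f true) + (1ℝ - 𝟙 (covers X ℓ S)) * prob t b (f false) ∎
      where
      select : ∀ a → 0ℝ ≤ (if a then prob t b (f true) else prob t b (f false))
      select true  = returnProb≥0 t b (f true)
      select false = returnProb≥0 t b (f false)

    returnProb≤1 : ∀ t b s → prob t b s ≤ 1ℝ
    returnProb≤1 zero    b s = inUnitInterval⇒0≤ 1-inUnitInterval
    returnProb≤1 (suc t) b s with step s
    ... | halt b′     = 𝟙≤1 (does (b′ Bool.≟ b))
    ... | compute s′  = returnProb≤1 t b s′
    ... | random k f  = average-≤ (λ i → returnProb≤1 t b (f i))
    ... | query X ℓ f = ≤-trans (≐⇒≤ (𝟙-select (covers X ℓ S) _ _)) (select (covers X ℓ S))
      where
      select : ∀ a → (if a then prob t b (f true) else prob t b (f false)) ≤ 1ℝ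
      select true  = returnProb≤1 t b (f true)
      select false = returnProb≤1 t b (f false)

    -- Stopping the observation earlier only replaces some outcomes by 0. This allows a common time
    -- to be chosen for all singletons.
    returnProb-mono : ∀ {t t′} → t ℕ.≤ t′ → ∀ b s → prob t b s ≤ prob t′ b s
    returnProb-mono {t′ = t′} z≤n b s = returnProb≥0 t′ b s
    returnProb-mono {suc t} {suc t′} (s≤s t≤t′) b s with step s
    ... | halt b′     = ≤-refl
    ... | compute s′  = returnProb-mono t≤t′ b s′
    ... | random k f  = average-mono-≤ (λ i → returnProb-mono t≤t′ b (f i))
    ... | query X ℓ f = begin
      𝟙 (covers X ℓ S) * prob t b (f true) + (1ℝ - 𝟙 (covers X ℓ S)) * prob t b (f false)    ≈⟨ 𝟙-select (covers X ℓ S) _ _ ⟩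
      (if covers X ℓ S then prob t b (f true) else prob t b (f false))                       ≲⟨ select (covers X ℓ S) ⟩
      (if covers X ℓ S then prob t′ b (f true) else prob t′ b (f false))                     ≈⟨ 𝟙-select (covers X ℓ S) _ _ ⟨
      𝟙 (covers X ℓ S) * prob t′ b (f true) + (1ℝ - 𝟙 (covers X ℓ S)) * prob t′ b (f false)  ∎
      where
      select : ∀ a → (if a then prob t b (f true) else prob t b (f false)) ≤
                     (if a then prob t′ b (f true) else prob t′ b (f false))
      select true  = returnProb-mono t≤t′ b (f true)
      select false = returnProb-mono t≤t′ b (f false)

  -- Weighted success on singletons against cost on the empty family

  module _ {c q : ℝ} (isDiscount : IsDiscount c q) {n : ℕ} where

    open IsDiscount isDiscount using (inUnit)
    open CoveredWeight isDiscount

    CostBoundedBy : State n → ℝ → Set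
    CostBoundedBy s B = ∀ {x} → Execution A ∅-oracle c s x → x ≤ B

    weightedYes : ℕ → State n → ℝ
    weightedYes t s = sumSubsets {n} (λ S → weight q S * returnProb A (singletonOracle S) t true s)

    -- Quantified over s and B because both change along an execution: each step moves to a
    -- successor and lowers the bound by its cost.
    WeightedYes≤Cost : ℕ → Set
    WeightedYes≤Cost t = ∀ s B → AlwaysReturns A ∅-oracle false s → CostBoundedBy s B → weightedYes t s ≤ B

    -- Prepending the transition turns an execution from s′ into one from s, so executions from s′
    -- cost at most B minus the step cost. The induction hypothesis is applied with that bound.
    successor-bound : ∀ {t s s′ B} → WeightedYes≤Cost t → AlwaysReturns A ∅-oracle false s → CostBoundedBy s B →
                      _⟶_ A ∅-oracle s s′ → stepCost A ∅-oracle c s + weightedYes t s′ ≤ B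
    successor-bound ih ret bound s⟶s′ = y≤z-x⇒x+y≤z
      (ih _ _ (alwaysReturns-step ret s⟶s′) (λ e → x+y≤z⇒y≤z-x (bound (s⟶s′ ∷ e))))

    x≤1+x : ∀ x → x ≤ 1ℝ + x
    x≤1+x x = begin
      x         ≈⟨ +-identityˡ x ⟨
      0ℝ + x    ≲⟨ +-mono-≤ (inUnitInterval⇒0≤ 1-inUnitInterval) ≤-refl ⟩
      1ℝ + x    ∎

    -- Where S is covered, the yes branch contributes at most its weight; elsewhere the answer is
    -- no, as on ∅. So only covered sets leave the execution on ∅, and their weight is paid for by
    -- the price c ^ ℓ of the query.
    weightedYes-query : ∀ X ℓ (f : Bool → State n) t →
      sumSubsets {n} (λ S → weight q S * (𝟙 (covers X ℓ S) * returnProb A (singletonOracle S) t true (f true) +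
                                      (1ℝ - 𝟙 (covers X ℓ S)) * returnProb A (singletonOracle S) t true (f false)))
      ≤ c ^ ℓ + weightedYes t (f false)
    weightedYes-query X ℓ f t = begin
      sumSubsets {n} (λ S → weight q S * (𝟙 (covers X ℓ S) * yesProb S (f true) + (1ℝ - 𝟙 (covers X ℓ S)) * yesProb S (f false)))
        ≲⟨ sumSubsets-mono-≤ {n} (λ S → *-monoˡ-≤ (weight-inUnitInterval inUnit S)
             (≤-trans (≐⇒≤ (𝟙-select (covers X ℓ S) _ _)) (select S (covers X ℓ S)))) ⟩
      sumSubsets {n} (λ S → weight q S * (𝟙 (covers X ℓ S) + yesProb S (f false)))
        ≈⟨ sumSubsets-cong {n} (λ S → pointwise λ k →
             ℚ.*-distribˡ-+ (seq (weight q S) k) (seq (𝟙 (covers X ℓ S)) k) (seq (yesProb S (f false)) k)) ⟩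
      sumSubsets {n} (λ S → weight q S * 𝟙 (covers X ℓ S) + weight q S * yesProb S (f false))
        ≈⟨ sumSubsets-+ {n} (λ S → weight q S * 𝟙 (covers X ℓ S)) (λ S → weight q S * yesProb S (f false)) ⟩
      coveredWeight X ℓ + weightedYes t (f false)
        ≲⟨ +-mono-≤ (coveredWeight≤c^ X ℓ) ≤-refl ⟩
      c ^ ℓ + weightedYes t (f false) ∎
      where
      yesProb : Subset n → State n → ℝ
      yesProb S = returnProb A (singletonOracle S) t true
      select : ∀ S b → (if b then yesProb S (f true) else yesProb S (f false)) ≤ 𝟙 b + yesProb S (f false)
      select S true  = begin
        yesProb S (f true)         ≲⟨ returnProb≤1 S t true (f true) ⟩
        1ℝ                         ≈⟨ pointwise (λ _ → ℚ.+-identityʳ 1ℚ) ⟨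
        1ℝ + 0ℝ                    ≲⟨ +-mono-≤ ≤-refl (returnProb≥0 S t true (f false)) ⟩
        1ℝ + yesProb S (f false)   ∎
      select S false = ≐⇒≤ (≐-sym (+-identityˡ _))

    -- The random choice is independent of S, so averaging commutes with the weighted sum.
    weightedYes-random : ∀ k (f : Fin (suc k) → State n) t →
      sumSubsets {n} (λ S → weight q S * average (λ i → returnProb A (singletonOracle S) t true (f i)))
      ≐ average (λ i → weightedYes t (f i))
    weightedYes-random k f t = begin-equality
      sumSubsets {n} (λ S → weight q S * average (λ i → yesProb S (f i)))
        ≈⟨ sumSubsets-cong {n} (λ S → average-* (weight q S) (λ i → yesProb S (f i))) ⟩
      sumSubsets {n} (λ S → average (λ i → weight q S * yesProb S (f i)))
        ≈⟨ sumSubsets-* {n} (fromℚ (ℤ.+ 1 ℚ./ suc k)) (λ S → sum (λ i → weight q S * yesProb S (f i))) ⟩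
      fromℚ (ℤ.+ 1 ℚ./ suc k) * sumSubsets {n} (λ S → sum (λ i → weight q S * yesProb S (f i)))
        ≈⟨ *-cong ≐-refl (sumSubsets-sum {n} {suc k} (λ i S → weight q S * yesProb S (f i))) ⟩
      average (λ i → weightedYes t (f i)) ∎
      where
      yesProb : Subset n → State n → ℝ
      yesProb S = returnProb A (singletonOracle S) t true

    weightedYes≤cost : ∀ t → WeightedYes≤Cost t
    -- Nothing has been returned yet, and the empty execution gives 0 ≤ B.
    weightedYes≤cost zero    s B _ bound = ≤-trans (≐⇒≤ (sumSubsets-zero {n} λ S → *-zeroʳ (weight q S))) (bound [])
    weightedYes≤cost (suc t) s B ret bound = go (step s) refl
      where
      unfold : ∀ {y : Subset n → ℝ} → (∀ S → returnProb A (singletonOracle S) (suc t) true s ≡ y S) →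
               weightedYes (suc t) s ≐ sumSubsets {n} (λ S → weight q S * y S)
      unfold p = sumSubsets-cong {n} (λ S → *-cong ≐-refl (≐-reflexive (p S)))

      next : ∀ {s′ x} → stepCost A ∅-oracle c s ≡ x → _⟶_ A ∅-oracle s s′ → x + weightedYes t s′ ≤ B
      next refl = successor-bound {t} {s} (weightedYes≤cost t) ret bound

      go : ∀ a → step s ≡ a → weightedYes (suc t) s ≤ B
      -- A run on ∅ can only halt with `false`, and halting does not consult the oracle, so the
      -- probability of `true` is 0 for every S.
      go (halt b)      eq with refl ← halt-result ret eq = begin
        weightedYes (suc t) s                          ≈⟨ unfold (λ S → returnProb-halt (singletonOracle S) eq) ⟩
        sumSubsets {n} (λ S → weight q S * 0ℝ)         ≈⟨ sumSubsets-zero {n} (λ S → *-zeroʳ (weight q S)) ⟩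
        0ℝ                                             ≲⟨ bound [] ⟩
        B                                              ∎
      go (compute s′)  eq = begin
        weightedYes (suc t) s       ≈⟨ unfold (λ S → returnProb-compute (singletonOracle S) eq) ⟩
        weightedYes t s′            ≲⟨ x≤1+x (weightedYes t s′) ⟩
        1ℝ + weightedYes t s′       ≲⟨ next (stepCost-compute ∅-oracle eq) (compute eq) ⟩
        B                           ∎
      go (random k f)  eq = begin
        weightedYes (suc t) s
          ≈⟨ unfold (λ S → returnProb-random (singletonOracle S) eq) ⟩
        sumSubsets {n} (λ S → weight q S * average (λ i → returnProb A (singletonOracle S) t true (f i)))
          ≈⟨ weightedYes-random k f t ⟩
        average (λ i → weightedYes t (f i))
          -- The unit cost of the choice is discarded. Every branch is bounded by B, hence so is the
          -- average.
          ≲⟨ average-≤ (λ i → ≤-trans (x≤1+x (weightedYes t (f i))) (next (stepCost-random ∅-oracle eq) (random eq i))) ⟩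
        B ∎
      go (query X ℓ f) eq = begin
        weightedYes (suc t) s
          ≈⟨ unfold (λ S → returnProb-query (singletonOracle S) eq) ⟩
        sumSubsets {n} (λ S → weight q S * (𝟙 (covers X ℓ S) * returnProb A (singletonOracle S) t true (f true) +
                                            (1ℝ - 𝟙 (covers X ℓ S)) * returnProb A (singletonOracle S) t true (f false)))
          ≲⟨ weightedYes-query X ℓ f t ⟩
        c ^ ℓ + weightedYes t (f false)
          -- On ∅ a yes has probability 0 < 1, so the no branch is a genuine transition.
          ≲⟨ next (stepCost-query ∅-oracle eq) (no eq (*<* (1ℚ , 0<1 , 0 , λ _ _ → ℚ.≤-reflexive (ℚ.+-identityˡ 1ℚ)))) ⟩
        B ∎

-- The constant polynomial 2 and the final estimate

eval-const : ∀ a x → eval (a ∷ []) x ≐ a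
eval-const a x = pointwise λ n → solve 2 (λ a x → a :+ x :* con 0ℚ := a) refl (seq a n) (seq x n)

-- Eventually the terms of the reciprocal times 2 are exactly 1, so they equal ½. This identifies
-- the polynomial factor with the success probability `½ℝ`.
recip-2 : ∀ {x} (0<x : 0ℝ < x) y → x ≐ 2ℝ → recip x 0<x * y ≤ ½ℝ * y
recip-2 {x} 0<x y x≐2 = eventually-≤ (proj₁ spec) λ n N≤n → ℚ.≤-reflexive (cong (ℚ._* seq y n)
  (trans (solve 1 (λ r → r := (r :* con 2ℚ) :* con ½) refl (seq r n))
  (trans (cong (λ u → (seq r n ℚ.* u) ℚ.* ½) (sym (seq-≡ x≐2 n)))
  (trans (cong (ℚ._* ½) (proj₂ (proj₂ spec n N≤n))) (ℚ.*-identityˡ ½)))))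
  where
  2ℚ = ℤ.+ 2 ℚ./ 1
  r = recip x 0<x
  spec = recip-inverse x 0<x

theorem2p10 : (c : ℝ) (1<c : 1ℝ < c) →
    Σ[ p ∈ List ℝ ] Σ[ 0<p ∈ (∀ n → 0ℝ < eval p (fromℕ n)) ]
    ((A : Algorithm) → SolvesDEC A → (n : ℕ) →
    CostAtLeast A c n
    (recip (eval p (fromℕ n)) (0<p n) * (2ℝ - recip c (1<⇒0< 1<c)) ^ n))
theorem2p10 c 1<c = p , 0<p , λ A solves n B bound → ≤+ε⇒≤ λ ε 0<ε →
  let open Algorithm A
      yesProb : ℕ → Subset n → ℝ
      yesProb t S = returnProb A (singletonOracle S) t true (init n)
      approx : ∀ S ε → 0ℚ ℚ.< ε → ∃ λ M → ∀ t → M ℕ.≤ t →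
               weight q S * ½ℝ ≤ weight q S * yesProb t S + fromℚ ε
      approx S ε 0<ε =
        let M , ½≤ = proj₁ (solves (singleton S) (singletonOracle S)) (S , ∈-singleton⁺ {X = S} refl)
                       (fromℚ ε) (*<* (ε , 0<ε , 0 , λ _ _ → ℚ.≤-reflexive (ℚ.+-identityˡ ε)))
        -- The algorithm guarantees the bound at the single time M; monotonicity carries it to all
        -- later t, as `sumSubsets-approx` requires.
        in M , λ t M≤t → weighted-½ (weight-inUnitInterval inUnit S) 0<ε
             (≤-trans ½≤ (+-mono-≤ (returnProb-mono A S M≤t true (init n)) ≤-refl))
      M , half≤ = sumSubsets-approx {n} (λ S → weight q S * ½ℝ) (λ t S → weight q S * yesProb t S) approx ε 0<ε
  in begin
    recip (eval p (fromℕ n)) (0<p n) * (2ℝ - recip c (1<⇒0< 1<c)) ^ n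
      ≲⟨ recip-2 (0<p n) _ (eval-const 2ℝ (fromℕ n)) ⟩
    ½ℝ * (2ℝ - recip c (1<⇒0< 1<c)) ^ n
      ≈⟨ *-cong ≐-refl (^-cong n 2-r≐1+q) ⟩
    ½ℝ * (1ℝ + q) ^ n
      ≈⟨ *-cong ≐-refl (sum-weight n q) ⟨
    ½ℝ * sumSubsets {n} (weight {n} q)
      ≈⟨ sumSubsets-* {n} ½ℝ (weight q) ⟨
    sumSubsets {n} (λ S → ½ℝ * weight {n} q S)
      ≈⟨ sumSubsets-cong {n} (λ S → pointwise λ k → ℚ.*-comm ½ (seq (weight q S) k)) ⟩
    sumSubsets {n} (λ S → weight {n} q S * ½ℝ)
      ≲⟨ half≤ M ℕ.≤-refl ⟩
    weightedYes A isDiscount M (init n) + fromℚ ε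
      -- The cost bound enters only here, for ∅ on the universe of size exactly n, where the
      -- algorithm must always return `false`.
      ≲⟨ +-mono-≤ (weightedYes≤cost A isDiscount M (init n) B
           (proj₂ (solves ∅ ∅-oracle) λ ()) (bound ℕ.≤-refl ∅ ∅-oracle)) ≤-refl ⟩
    B + fromℚ ε ∎
  where
  q = 1ℝ - recip c (1<⇒0< 1<c)
  isDiscount = 1-1/c-isDiscount 1<c
  open IsDiscount isDiscount using (inUnit)
  p : List ℝ
  p = 2ℝ ∷ []
  0<p : ∀ n → 0ℝ < eval p (fromℕ n)
  0<p n = *<* (1ℚ , 0<1 , 0 , λ k _ → subst (0ℚ ℚ.+ 1ℚ ℚ.≤_) (sym (seq-≡ (eval-const 2ℝ (fromℕ n)) k))
            (ℚ.*≤* (ℤ.+≤+ (s≤s z≤n))))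
  2-r≐1+q : 2ℝ - recip c (1<⇒0< 1<c) ≐ 1ℝ + q
  2-r≐1+q = pointwise λ k → solve 1 (λ r → con (ℤ.+ 2 ℚ./ 1) :- r := con 1ℚ :+ (con 1ℚ :- r)) refl
              (seq (recip c (1<⇒0< 1<c)) k)
  -- Since w ≤ 1, the slack after multiplication by w is still at most ε.
  weighted-½ : ∀ {w x ε} → InUnitInterval w → 0ℚ ℚ.< ε → ½ℝ ≤ x + fromℚ ε → w * ½ℝ ≤ w * x + fromℚ ε
  weighted-½ {w} {x} {ε} u 0<ε ½≤x+ε = begin
    w * ½ℝ                ≲⟨ *-monoˡ-≤ u ½≤x+ε ⟩
    w * (x + fromℚ ε)     ≈⟨ pointwise (λ k → solve 3 (λ w x e → w :* (x :+ e) := w :* x :+ e :* w) refl (seq w k) (seq x k) ε) ⟩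
    w * x + fromℚ ε * w   ≲⟨ +-mono-≤ ≤-refl (ε*w≤ε u 0<ε) ⟩
    w * x + fromℚ ε       ∎
    where
    ε*w≤ε : ∀ {w ε} → InUnitInterval w → 0ℚ ℚ.< ε → fromℚ ε * w ≤ fromℚ ε
    ε*w≤ε {w} {ε} (inUnitInterval N _ w≤1) 0<ε = eventually-≤ N λ n N≤n →
      let instance _ = ℚ.nonNegative (ℚ.<⇒≤ 0<ε)
      in subst (ε ℚ.* seq w n ℚ.≤_) (ℚ.*-identityʳ ε) (ℚ.*-monoˡ-≤-nonNeg ε (w≤1 n N≤n))
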